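{- Let $m$ be a positive integer and let $e_0,\dots,e_{2m-1}\subseteq\mathbb Z/2m\mathbb Z$ be a central antipodal-free Hamiltonian label system that has no free-label two-gap Berge cycle of length $m+1$. For $1\le k\le m-2$ write $\bar k=m-1-k$, and let $\rho_p(k)\in\{+,-,0\}$ denote the spin of row $p$ in column $k$. (i) If $m$ is even, there are signs $\sigma_k\in\{+,-\}$ for $1\le k\le m-2$ with $\sigma_{\bar k}=-\sigma_k$ for all $k$, such that for all $p\in\mathbb Z/2m\mathbb Z$ and all $1\le k\le m-2$, $\rho_p(k)\ne 0$ implies $\rho_p(k)=\sigma_k$. (ii) If $m=2h+1$ is odd, the same conclusion holds on the noncentral columns: there are signs $\sigma_k\in\{+,-\}$ for $1\le k\le m-2$, $k\ne h$, with $\sigma_{\bar k}=-\sigma_k$, such that for all $p$ and all $k\ne h$, $\rho_p(k)\neq 0$ implies $\rho_p(k)=\sigma_k$ (with no exceptional noncentral cell). The central column $h$ is unrestricted.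
   Context: All indices $p$ and vertices are elements of $\mathbb Z/2m\mathbb Z$. For $a,b\in\mathbb Z/2m\mathbb Z$, $[a,b]^+$ denotes the clockwise interval $\{a,a+1,\dots,b\}$ (both endpoints included). An antipodal pair is a set $\{x,x+m\}$. A central antipodal-free Hamiltonian label system is a collection of distinct $(m-1)$-element sets $e_0,\dots,e_{2m-1}\subseteq\mathbb Z/2m\mathbb Z$ such that $\{p,p+1\}\subseteq e_p$ for every $p$ and no $e_p$ contains an antipodal pair. Spins: for $p\in\mathbb Z/2m\mathbb Z$ and $1\le k\le m-2$, $\rho_p(k)=+$ if $p-k\in e_p$; $\rho_p(k)=-$ if $p-k+m\in e_p$; and $\rho_p(k)=0$ if neither $p-k$ nor $p-k+m$ lies in $e_p$. Here $p$ is the row and $k$ the column. On signs, $-\sigma$ denotes the opposite sign. Free-label two-gap Berge cycle: the system has a free-label two-gap Berge cycle of length $m+1$ if there exist integers $1\le d,e\le 2m-1$ with $d+e=m+1$, two disjoint cyclic intervals $I=[x,x+d-1]^+$ and $J=[y,y+e-1]^+$ in $\mathbb Z/2m\mathbb Z$ (so $|I|=d$, $|J|=e$), and two distinct indices $i,j\in I\cup J$ such that $\{x,x+d\}\subseteq e_i$ and $\{y,y+e\}\subseteq e_j$. (In general such a configuration yields a Berge cycle of length $2m-d-e+2$.) In (ii), $h=(m-1)/2$ is the unique column with $\bar h=h$, called the central column; for $m$ even no column satisfies $\bar k=k$. -}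

module Defs where

open import Data.Bool using (if_then_else_)
open import Data.Fin using (Fin; toℕ)
open import Data.Fin.Subset using (Subset; _∈_; _∪_; _∩_; ∣_∣; Empty)
open import Data.Fin.Subset.Properties using (_∈?_)
open import Data.Maybe using (Maybe; just; nothing)
open import Data.Nat using (ℕ; _+_; _*_; _∸_; _≤_; _≤?_; NonZero)
open import Data.Nat.DivMod using (_%_; _mod_)
open import Data.Nat.Properties using (m*n≢0)
open import Data.Product using (_×_)
open import Data.Sign as Sign using (Sign)
open import Data.Vec using (tabulate)
open import Function.Definitions using (Injective)
open import Relation.Binary.PropositionalEquality using (_≡_; _≢_)
open import Relation.Nullary using (¬_; does)

-- ℤ/nℤ is represented by Fin n, and translation by an integer ±k by
-- p ⊕ k = p + k and p ⊖ k = p - k, with k a natural number of any size.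
module _ {n : ℕ} .{{_ : NonZero n}} where

  infixl 6 _⊕_ _⊖_

  _⊕_ : Fin n → ℕ → Fin n
  p ⊕ k = (toℕ p + k) mod n

  _⊖_ : Fin n → ℕ → Fin n
  p ⊖ k = (toℕ p + (n ∸ k % n)) mod n

  -- z lies in {a, a+1, …, b} iff, moving clockwise from a, one meets z no
  -- later than b, i.e. the least residue of z - a is at most that of b - a.
  [_,_]⁺ : Fin n → Fin n → Subset n
  [ a , b ]⁺ = tabulate λ z → does (toℕ (z ⊖ toℕ a) ≤? toℕ (b ⊖ toℕ a))

module _ (m : ℕ) .{{_ : NonZero m}} where

  private instance
    2m≢0 : NonZero (2 * m)
    2m≢0 = m*n≢0 2 m

  Labels : Set
  Labels = Fin (2 * m) → Subset (2 * m)

  record IsCentralAntipodalFreeHamiltonian (E : Labels) : Set where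
    field
      distinct      : Injective _≡_ _≡_ E
      size          : ∀ p → ∣ E p ∣ ≡ m ∸ 1
      hamiltonian   : ∀ p → p ∈ E p × p ⊕ 1 ∈ E p
      antipodalFree : ∀ p x → ¬ (x ∈ E p × x ⊕ m ∈ E p)

  -- A cycle of this kind with gaps d and e has length 2m - d - e + 2, so
  -- length m + 1 amounts to d + e = m + 1.
  record FreeLabelTwoGapBergeCycle (E : Labels) : Set where
    field
      d e     : ℕ
      1≤d     : 1 ≤ d
      d≤2m-1  : d ≤ 2 * m ∸ 1
      1≤e     : 1 ≤ e
      e≤2m-1  : e ≤ 2 * m ∸ 1
      d+e≡m+1 : d + e ≡ m + 1
      x y     : Fin (2 * m)

    I : Subset (2 * m)
    I = [ x , x ⊕ (d ∸ 1) ]⁺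

    J : Subset (2 * m)
    J = [ y , y ⊕ (e ∸ 1) ]⁺

    field
      disjoint : Empty (I ∩ J)
      i j      : Fin (2 * m)
      i≢j      : i ≢ j
      i∈I∪J    : i ∈ I ∪ J
      j∈I∪J    : j ∈ I ∪ J
      xGap     : x ∈ E i × x ⊕ d ∈ E i
      yGap     : y ∈ E j × y ⊕ e ∈ E j

  -- The spin 0 is nothing.  When E is antipodal-free at most one of the two
  -- membership tests succeeds, so their order is immaterial.
  spin : Labels → Fin (2 * m) → ℕ → Maybe Sign
  spin E p k =
    if does (p ⊖ k ∈? E p) then just Sign.+
    else if does (p ⊖ k ⊕ m ∈? E p) then just Sign.-
    else nothing

  bar : ℕ → ℕ
  bar k = m ∸ 1 ∸ k

{-# OPTIONS --safe #-}
module Submission where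

-- Write K = bar k and d = k + 1.  A spin + in row p of column k puts {x, x + d} into e_p
-- for x = p - k, and a spin - puts {p, p + K + 1} into it.  Two such gaps with lengths
-- adding up to m + 1 form a free-label two-gap Berge cycle when they are disjoint, so
--   (a) + in row p and - in row p + t of column k exclude each other for 1 ≤ t ≤ m;
--   (b) a sign in row p of column k excludes the same sign in row p + K + 1 + u of
--       column K for 0 ≤ u < m.
-- As e_p meets all but one antipodal pair, the columns k ≠ K are never both 0 in a row.
-- If column k has - in row q and + in row q + s, then s < m by (a), row q + s + K + 1
-- of column K is 0 by (b), and hence by (a) column k has + there; iterating, s exceeds m.
-- So column k has one sign only.  If column K had the same one, (b) would propagate it
-- in column k from p to p + K + 1 and p + K + 2, hence to all rows, contradicting (b).

open import Data.Fin using (Fin; zero; toℕ; splitAt; _↑ˡ_; _↑ʳ_)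
open import Data.Fin.Properties
  using (toℕ-fromℕ<; toℕ-injective; toℕ<n; toℕ-↑ˡ; toℕ-↑ʳ; splitAt⁻¹-↑ˡ; splitAt⁻¹-↑ʳ)
open import Data.Fin.Subset
  using (Subset; inside; outside; _∈_; _∉_; _∪_; _∩_; _⊆_; ∣_∣; Empty; ⊤; _-_)
open import Data.Fin.Subset.Properties
  using (_∈?_; ∈⊤; ∣⊤∣≡n; p⊆q⇒∣p∣≤∣q∣; x∈p⇒∣p-x∣<∣p∣; x∈p∧x≢y⇒x∈p-y;
         x∈p∪q⁻; x∈p∪q⁺; x∈p∩q⁻; x∈p∩q⁺; drop-∷-Empty)
open import Data.Maybe using (Maybe; just; nothing)
open import Data.Nat hiding (∣_-_∣)
open import Data.Nat.DivMod
open import Data.Nat.Divisibility using (_∣_; ∣1⇒≡1; ∣m+n∣m⇒∣n; m∣m*n)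
open import Data.Nat.Properties
open import Data.Nat.Tactic.RingSolver using (solve-∀)
open import Data.Product using (Σ-syntax; ∃-syntax; _×_; _,_; proj₁; proj₂)
open import Data.Sign as Sign using (Sign; opposite)
open import Data.Sign.Properties using (opposite-involutive)
open import Data.Sum using (_⊎_; inj₁; inj₂)
open import Data.Vec using (tabulate; lookup; _∷_; []; here)
open import Data.Vec.Properties using (lookup∘tabulate; tabulate∘lookup; []=⇒lookup; lookup⇒[]=)
open import Relation.Binary.PropositionalEquality
open import Relation.Nullary using (¬_; yes; no; does; contradiction)
open import Relation.Nullary.Decidable using (dec-true)
open import Function using (_∘_)
open import Defs

-- Translations, offsets and clockwise intervals in ℤ/nℤ.

module _ {n : ℕ} .{{_ : NonZero n}} where

  %-+ˡ : ∀ a b → (a % n + b) % n ≡ (a + b) % n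
  %-+ˡ a b = begin
    (a % n + b) % n          ≡⟨ %-distribˡ-+ (a % n) b n ⟩
    (a % n % n + b % n) % n  ≡⟨ cong (λ r → (r + b % n) % n) (m%n%n≡m%n a n) ⟩
    (a % n + b % n) % n      ≡⟨ %-distribˡ-+ a b n ⟨
    (a + b) % n              ∎
    where open ≡-Reasoning

  toℕ-⊕ : ∀ (p : Fin n) k → toℕ (p ⊕ k) ≡ (toℕ p + k) % n
  toℕ-⊕ p k = toℕ-fromℕ< _

  toℕ-% : (p : Fin n) → toℕ p % n ≡ toℕ p
  toℕ-% p = m<n⇒m%n≡m (toℕ<n p)

  ⊕-⊕ : ∀ (p : Fin n) a b → p ⊕ a ⊕ b ≡ p ⊕ (a + b)
  ⊕-⊕ p a b = toℕ-injective (begin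
    toℕ (p ⊕ a ⊕ b)            ≡⟨ toℕ-⊕ (p ⊕ a) b ⟩
    (toℕ (p ⊕ a) + b) % n      ≡⟨ cong (λ r → (r + b) % n) (toℕ-⊕ p a) ⟩
    ((toℕ p + a) % n + b) % n  ≡⟨ %-+ˡ (toℕ p + a) b ⟩
    (toℕ p + a + b) % n        ≡⟨ cong (_% n) (+-assoc (toℕ p) a b) ⟩
    (toℕ p + (a + b)) % n      ≡⟨ toℕ-⊕ p (a + b) ⟨
    toℕ (p ⊕ (a + b))          ∎)
    where open ≡-Reasoning

  ⊕-multiple : ∀ (p : Fin n) a c → p ⊕ (a + c * n) ≡ p ⊕ a
  ⊕-multiple p a c = toℕ-injective (begin
    toℕ (p ⊕ (a + c * n))        ≡⟨ toℕ-⊕ p _ ⟩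
    (toℕ p + (a + c * n)) % n    ≡⟨ cong (_% n) (+-assoc (toℕ p) a (c * n)) ⟨
    (toℕ p + a + c * n) % n      ≡⟨ [m+kn]%n≡m%n (toℕ p + a) c n ⟩
    (toℕ p + a) % n              ≡⟨ toℕ-⊕ p a ⟨
    toℕ (p ⊕ a)                  ∎)
    where open ≡-Reasoning

  ⊕-0 : (p : Fin n) → p ⊕ 0 ≡ p
  ⊕-0 p = toℕ-injective (begin
    toℕ (p ⊕ 0)        ≡⟨ toℕ-⊕ p 0 ⟩
    (toℕ p + 0) % n    ≡⟨ cong (_% n) (+-identityʳ (toℕ p)) ⟩
    toℕ p % n          ≡⟨ toℕ-% p ⟩
    toℕ p              ∎)
    where open ≡-Reasoning

  -- The least residue of z - a, the quantity that `[_,_]⁺` compares. Statements about intervals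
  -- thereby become inequalities between naturals below n.
  offset : Fin n → Fin n → ℕ
  offset a z = toℕ (z ⊖ toℕ a)

  private
    ⊖-toℕ : ∀ (z a : Fin n) → offset a z ≡ (toℕ z + (n ∸ toℕ a)) % n
    ⊖-toℕ z a = trans (toℕ-⊕ z _) (cong (λ r → (toℕ z + (n ∸ r)) % n) (toℕ-% a))

  offset<n : ∀ a z → offset a z < n
  offset<n a z = toℕ<n (z ⊖ toℕ a)

  ⊕-offset : ∀ a z → a ⊕ offset a z ≡ z
  ⊕-offset a z = toℕ-injective (begin
    toℕ (a ⊕ offset a z)                       ≡⟨ toℕ-⊕ a _ ⟩
    (toℕ a + offset a z) % n                   ≡⟨ cong (_% n) (+-comm (toℕ a) _) ⟩
    (offset a z + toℕ a) % n                   ≡⟨ cong (λ r → (r + toℕ a) % n) (⊖-toℕ z a) ⟩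
    ((toℕ z + (n ∸ toℕ a)) % n + toℕ a) % n    ≡⟨ %-+ˡ _ (toℕ a) ⟩
    (toℕ z + (n ∸ toℕ a) + toℕ a) % n          ≡⟨ cong (_% n) (+-assoc (toℕ z) _ _) ⟩
    (toℕ z + (n ∸ toℕ a + toℕ a)) % n          ≡⟨ cong (λ r → (toℕ z + r) % n) (m∸n+n≡m (<⇒≤ (toℕ<n a))) ⟩
    (toℕ z + n) % n                            ≡⟨ [m+n]%n≡m%n (toℕ z) n ⟩
    toℕ z % n                                  ≡⟨ toℕ-% z ⟩
    toℕ z                                      ∎)
    where open ≡-Reasoning

  offset-⊕ : ∀ a {s} → s < n → offset a (a ⊕ s) ≡ s
  offset-⊕ a {s} s<n = begin
    offset a (a ⊕ s)                      ≡⟨ ⊖-toℕ (a ⊕ s) a ⟩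
    (toℕ (a ⊕ s) + (n ∸ toℕ a)) % n       ≡⟨ cong (λ r → (r + (n ∸ toℕ a)) % n) (toℕ-⊕ a s) ⟩
    ((toℕ a + s) % n + (n ∸ toℕ a)) % n   ≡⟨ %-+ˡ (toℕ a + s) _ ⟩
    (toℕ a + s + (n ∸ toℕ a)) % n         ≡⟨ cong (λ r → (r + (n ∸ toℕ a)) % n) (+-comm (toℕ a) s) ⟩
    (s + toℕ a + (n ∸ toℕ a)) % n         ≡⟨ cong (_% n) (+-assoc s _ _) ⟩
    (s + (toℕ a + (n ∸ toℕ a))) % n       ≡⟨ cong (λ r → (s + r) % n) (m+[n∸m]≡n (<⇒≤ (toℕ<n a))) ⟩
    (s + n) % n                           ≡⟨ [m+n]%n≡m%n s n ⟩
    s % n                                 ≡⟨ m<n⇒m%n≡m s<n ⟩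
    s                                     ∎
    where open ≡-Reasoning

  ⊕-cancelˡ-< : ∀ (a : Fin n) {s t} → s < n → t < n → a ⊕ s ≡ a ⊕ t → s ≡ t
  ⊕-cancelˡ-< a s<n t<n eq =
    trans (sym (offset-⊕ a s<n)) (trans (cong (offset a) eq) (offset-⊕ a t<n))

  private
    lookup-interval : ∀ (a b z : Fin n) →
      lookup [ a , b ]⁺ z ≡ does (offset a z ≤? offset a b)
    lookup-interval a b z = lookup∘tabulate _ z

  ∈-interval⁺ : ∀ (a : Fin n) {s t} → t < n → s ≤ t → a ⊕ s ∈ [ a , a ⊕ t ]⁺
  ∈-interval⁺ a {s} {t} t<n s≤t = lookup⇒[]= _ _
    (trans (lookup-interval a _ _)
           (dec-true (_ ≤? _) (subst₂ _≤_
             (sym (offset-⊕ a (≤-<-trans s≤t t<n))) (sym (offset-⊕ a t<n)) s≤t)))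

  ∈-interval⁻ : ∀ (a : Fin n) {t z} → t < n → z ∈ [ a , a ⊕ t ]⁺ → offset a z ≤ t
  ∈-interval⁻ a {t} {z} t<n z∈ with offset a z ≤? offset a (a ⊕ t) in eq
  ... | yes le = subst (offset a z ≤_) (offset-⊕ a t<n) le
  ... | no  _  = contradiction
    (trans (sym ([]=⇒lookup z∈)) (trans (lookup-interval a _ z) (cong does eq))) λ ()

-- Cardinalities of finite subsets.

∣p∪q∣≡∣p∣+∣q∣ : ∀ {n} (p q : Subset n) → Empty (p ∩ q) → ∣ p ∪ q ∣ ≡ ∣ p ∣ + ∣ q ∣
∣p∪q∣≡∣p∣+∣q∣ []            []            _ = refl
∣p∪q∣≡∣p∣+∣q∣ (inside ∷ p)  (inside ∷ q)  d = contradiction (zero , here) d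
∣p∪q∣≡∣p∣+∣q∣ (inside ∷ p)  (outside ∷ q) d = cong suc (∣p∪q∣≡∣p∣+∣q∣ p q (drop-∷-Empty d))
∣p∪q∣≡∣p∣+∣q∣ (outside ∷ p) (inside ∷ q)  d =
  trans (cong suc (∣p∪q∣≡∣p∣+∣q∣ p q (drop-∷-Empty d))) (sym (+-suc ∣ p ∣ ∣ q ∣))
∣p∪q∣≡∣p∣+∣q∣ (outside ∷ p) (outside ∷ q) d = ∣p∪q∣≡∣p∣+∣q∣ p q (drop-∷-Empty d)

two-missing⇒2+∣p∣≤n : ∀ {n} (p : Subset n) {i j} → i ≢ j → i ∉ p → j ∉ p → 2 + ∣ p ∣ ≤ n
two-missing⇒2+∣p∣≤n {n} p {i} {j} i≢j i∉p j∉p = begin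
  2 + ∣ p ∣           ≤⟨ s≤s (s≤s (p⊆q⇒∣p∣≤∣q∣ p⊆)) ⟩
  2 + ∣ ⊤ - i - j ∣   ≤⟨ s≤s (x∈p⇒∣p-x∣<∣p∣ (x∈p∧x≢y⇒x∈p-y ∈⊤ (i≢j ∘ sym))) ⟩
  1 + ∣ ⊤ - i ∣       ≤⟨ x∈p⇒∣p-x∣<∣p∣ {p = ⊤} (∈⊤ {x = i}) ⟩
  ∣ ⊤ {n} ∣           ≡⟨ ∣⊤∣≡n n ⟩
  n                   ∎
  where
  open ≤-Reasoning
  p⊆ : p ⊆ ⊤ - i - j
  p⊆ x∈p = x∈p∧x≢y⇒x∈p-y (x∈p∧x≢y⇒x∈p-y ∈⊤ λ { refl → i∉p x∈p }) λ { refl → j∉p x∈p }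

restrictˡ : ∀ m {n} → Subset (m + n) → Subset m
restrictˡ m {n} S = tabulate λ i → lookup S (i ↑ˡ n)

restrictʳ : ∀ m {n} → Subset (m + n) → Subset n
restrictʳ m S = tabulate λ i → lookup S (m ↑ʳ i)

∣S∣≡∣restrictˡ∣+∣restrictʳ∣ : ∀ m {n} (S : Subset (m + n)) →
  ∣ S ∣ ≡ ∣ restrictˡ m S ∣ + ∣ restrictʳ m S ∣
∣S∣≡∣restrictˡ∣+∣restrictʳ∣ zero    S             = cong ∣_∣ (sym (tabulate∘lookup S))
∣S∣≡∣restrictˡ∣+∣restrictʳ∣ (suc m) (inside ∷ S)  = cong suc (∣S∣≡∣restrictˡ∣+∣restrictʳ∣ m S)
∣S∣≡∣restrictˡ∣+∣restrictʳ∣ (suc m) (outside ∷ S) = ∣S∣≡∣restrictˡ∣+∣restrictʳ∣ m S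

∈-restrictˡ⁻ : ∀ m {n} {S : Subset (m + n)} {i} → i ∈ restrictˡ m S → i ↑ˡ n ∈ S
∈-restrictˡ⁻ m {n} {S} {i} i∈ =
  lookup⇒[]= _ _ (trans (sym (lookup∘tabulate (λ j → lookup S (j ↑ˡ n)) i)) ([]=⇒lookup i∈))

∈-restrictʳ⁻ : ∀ m {n} {S : Subset (m + n)} {i} → i ∈ restrictʳ m S → m ↑ʳ i ∈ S
∈-restrictʳ⁻ m {n} {S} {i} i∈ =
  lookup⇒[]= _ _ (trans (sym (lookup∘tabulate (λ j → lookup S (m ↑ʳ j)) i)) ([]=⇒lookup i∈))

-- Antipodal pairs in ℤ/2mℤ.

module _ {m : ℕ} .{{_ : NonZero m}} where

  private instance
    2m≢0 : NonZero (2 * m)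
    2m≢0 = m*n≢0 2 m

  ⊕-2m : ∀ (p : Fin (2 * m)) {a b} → a ≡ b + 2 * m → p ⊕ a ≡ p ⊕ b
  ⊕-2m p {b = b} refl =
    trans (cong (λ r → p ⊕ (b + r)) (sym (*-identityˡ (2 * m)))) (⊕-multiple p b 1)

  ⊕m⊕m : ∀ (p : Fin (2 * m)) → p ⊕ m ⊕ m ≡ p
  ⊕m⊕m p = trans (⊕-⊕ p m m) (trans (⊕-2m p (cong (m +_) (sym (+-identityʳ m)))) (⊕-0 p))

  -- The two members of the antipodal pair numbered i. The form of `high` follows the unfolding of
  -- `2 * m` to `m + (m + 0)`.
  low high : Fin m → Fin (2 * m)
  low  i = i ↑ˡ (m + 0)
  high i = m ↑ʳ (i ↑ˡ 0)

  low⊕m : ∀ i → low i ⊕ m ≡ high i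
  low⊕m i = toℕ-injective (begin
    toℕ (low i ⊕ m)              ≡⟨ toℕ-⊕ (low i) m ⟩
    (toℕ (low i) + m) % (2 * m)  ≡⟨ cong (λ r → (r + m) % (2 * m)) (toℕ-↑ˡ i (m + 0)) ⟩
    (toℕ i + m) % (2 * m)        ≡⟨ cong (_% (2 * m)) toℕ-high ⟨
    toℕ (high i) % (2 * m)       ≡⟨ toℕ-% (high i) ⟩
    toℕ (high i)                 ∎)
    where
    open ≡-Reasoning
    toℕ-high : toℕ (high i) ≡ toℕ i + m
    toℕ-high = trans (toℕ-↑ʳ m (i ↑ˡ 0)) (trans (cong (m +_) (toℕ-↑ˡ i 0)) (+-comm m (toℕ i)))

  high⊕m : ∀ i → high i ⊕ m ≡ low i
  high⊕m i = trans (cong (_⊕ m) (sym (low⊕m i))) (⊕m⊕m (low i))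

  low⊎high : ∀ (x : Fin (2 * m)) → ∃[ i ] (low i ≡ x ⊎ high i ≡ x)
  low⊎high x with splitAt m x in eq
  ... | inj₁ i = i , inj₁ (splitAt⁻¹-↑ˡ eq)
  ... | inj₂ j with splitAt m {0} j in eq′
  ...   | inj₁ i = i , inj₂ (trans (cong (m ↑ʳ_) (splitAt⁻¹-↑ˡ eq′)) (splitAt⁻¹-↑ʳ eq))

  antipodal-class : ∀ (x : Fin (2 * m)) → ∃[ i ] (low i ≡ x × high i ≡ x ⊕ m ⊎ high i ≡ x × low i ≡ x ⊕ m)
  antipodal-class x with low⊎high x
  ... | i , inj₁ refl = i , inj₁ (refl , sym (low⊕m i))
  ... | i , inj₂ refl = i , inj₂ (refl , sym (high⊕m i))

  -- Numbering the antipodal pairs by `Fin m`, the lower and upper halves of S become subsets L and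
  -- R. They are disjoint because S contains no pair, so `L ∪ R` has as many elements as S, and it
  -- omits the numbers of the two missed pairs.
  two-classes-missing⇒2+∣S∣≤m : ∀ (S : Subset (2 * m)) → (∀ x → ¬ (x ∈ S × x ⊕ m ∈ S)) →
    ∀ {x y} → x ∉ S → x ⊕ m ∉ S → y ∉ S → y ⊕ m ∉ S → x ≢ y → x ≢ y ⊕ m → 2 + ∣ S ∣ ≤ m
  two-classes-missing⇒2+∣S∣≤m S free {x} {y} x∉ x′∉ y∉ y′∉ x≢y x≢y′ =
    subst (λ c → 2 + c ≤ m) (sym ∣S∣≡)
      (two-missing⇒2+∣p∣≤n (L ∪ R) i≢j (missing x∉ x′∉ classˣ) (missing y∉ y′∉ classʸ))
    where
    L R : Subset m
    L = restrictˡ m S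
    R = restrictˡ m (restrictʳ m S)

    L⁻ : ∀ {i} → i ∈ L → low i ∈ S
    L⁻ = ∈-restrictˡ⁻ m

    R⁻ : ∀ {i} → i ∈ R → high i ∈ S
    R⁻ = ∈-restrictʳ⁻ m ∘ ∈-restrictˡ⁻ m

    L∩R-empty : Empty (L ∩ R)
    L∩R-empty (i , i∈) with l , r ← x∈p∩q⁻ L R i∈ =
      free (low i) (L⁻ l , subst (_∈ S) (sym (low⊕m i)) (R⁻ r))

    ∣S∣≡ : ∣ S ∣ ≡ ∣ L ∪ R ∣
    ∣S∣≡ = begin
      ∣ S ∣                            ≡⟨ ∣S∣≡∣restrictˡ∣+∣restrictʳ∣ m S ⟩
      ∣ L ∣ + ∣ restrictʳ m S ∣        ≡⟨ cong (∣ L ∣ +_) (∣S∣≡∣restrictˡ∣+∣restrictʳ∣ m {0} (restrictʳ m S)) ⟩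
      ∣ L ∣ + (∣ R ∣ + 0)              ≡⟨ cong (∣ L ∣ +_) (+-identityʳ ∣ R ∣) ⟩
      ∣ L ∣ + ∣ R ∣                    ≡⟨ ∣p∪q∣≡∣p∣+∣q∣ L R L∩R-empty ⟨
      ∣ L ∪ R ∣                        ∎
      where open ≡-Reasoning

    classˣ = antipodal-class x
    classʸ = antipodal-class y

    missing : ∀ {z} → z ∉ S → z ⊕ m ∉ S →
      (c : ∃[ i ] (low i ≡ z × high i ≡ z ⊕ m ⊎ high i ≡ z × low i ≡ z ⊕ m)) → proj₁ c ∉ L ∪ R
    missing z∉ z′∉ (i , c) i∈ with x∈p∪q⁻ L R i∈ | c
    ... | inj₁ l | inj₁ (e , _) = z∉ (subst (_∈ S) e (L⁻ l))
    ... | inj₁ l | inj₂ (_ , e) = z′∉ (subst (_∈ S) e (L⁻ l))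
    ... | inj₂ r | inj₁ (_ , e) = z′∉ (subst (_∈ S) e (R⁻ r))
    ... | inj₂ r | inj₂ (e , _) = z∉ (subst (_∈ S) e (R⁻ r))

    i≢j : proj₁ classˣ ≢ proj₁ classʸ
    i≢j eq with classˣ | classʸ
    i≢j refl | i , inj₁ (a , _) | .i , inj₁ (b , _) = x≢y (trans (sym a) b)
    i≢j refl | i , inj₁ (a , _) | .i , inj₂ (_ , b) = x≢y′ (trans (sym a) b)
    i≢j refl | i , inj₂ (a , _) | .i , inj₁ (_ , b) = x≢y′ (trans (sym a) b)
    i≢j refl | i , inj₂ (a , _) | .i , inj₂ (b , _) = x≢y (trans (sym a) b)

-- Arithmetic of the column reflection.

module _ {m : ℕ} .{{_ : NonZero m}} where

  private
    m-2≤m-1 : m ∸ 2 ≤ m ∸ 1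
    m-2≤m-1 = ∸-monoʳ-≤ m (s≤s z≤n)

  -- Replaces truncated subtraction by an equation symmetric in the two columns, up to
  -- commutativity; the lemmas on columns k and K assume it in this form.
  m≡1+k+bar : ∀ k → k ≤ m ∸ 2 → m ≡ suc (k + bar m k)
  m≡1+k+bar k k≤m-2 =
    sym (trans (cong suc (m+[n∸m]≡n (≤-trans k≤m-2 m-2≤m-1))) (suc-pred m))

  bar-involutive : ∀ k → k ≤ m ∸ 2 → bar m (bar m k) ≡ k
  bar-involutive k k≤m-2 = m∸[m∸n]≡n (≤-trans k≤m-2 m-2≤m-1)

-- Gaps, two-gap Berge cycles, and spins as memberships.

module _ {m : ℕ} .{{_ : NonZero m}} {E : Labels m} where

  private instance
    2m≢0 : NonZero (2 * m)
    2m≢0 = m*n≢0 2 m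

  -- One half of a two-gap cycle, with gap length a + 1: the index `x ⊕ s` lies in the interval from
  -- x to x + a, and its label contains both ends x and x + a + 1.
  record Gap (x : Fin (2 * m)) (a : ℕ) : Set where
    constructor gap
    field
      s     : ℕ
      s≤a   : s ≤ a
      start : x ∈ E (x ⊕ s)
      end   : x ⊕ suc a ∈ E (x ⊕ s)

  private
    length-bound : ∀ a b {m} → m ≡ suc (a + b) → suc a ≤ 2 * m ∸ 1
    length-bound a b refl = begin
      suc a                        ≤⟨ s≤s (m≤m+n a b) ⟩
      suc (a + b)                  ≤⟨ m≤m+n _ _ ⟩
      suc (a + b) + 0              ≤⟨ m≤n+m _ _ ⟩
      a + b + (suc (a + b) + 0)    ∎
      where open ≤-Reasoning

    a<2m : ∀ a b {m} → m ≡ suc (a + b) → a < 2 * m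
    a<2m a b eq = ≤-trans (length-bound a b eq) (m∸n≤m _ 1)

    lengths : ∀ a b {m} → m ≡ suc (a + b) → suc a + suc b ≡ m + 1
    lengths a b refl = identity a b
      where
      identity : ∀ a b → suc a + suc b ≡ suc (a + b) + 1
      identity = solve-∀

    gap-sum : ∀ a b u {m} → m ≡ suc (a + b) → u < m → suc a + u + b < 2 * m
    gap-sum a b u {m} eq u<m = begin-strict
      suc a + u + b  ≡⟨ rearrange a b u ⟩
      suc (a + b) + u  ≡⟨ cong (_+ u) eq ⟨
      m + u          <⟨ +-monoʳ-< m u<m ⟩
      m + m          ≡⟨ cong (m +_) (+-identityʳ m) ⟨
      2 * m          ∎
      where
      open ≤-Reasoning
      rearrange : ∀ a b u → suc a + u + b ≡ suc (a + b) + u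
      rearrange = solve-∀

  -- The second interval starts u points after the first one ends. With u < m it ends before a full
  -- turn from x, so the intervals are disjoint, and indices taken from them are distinct.
  separated-gaps⇒cycle : ∀ {a b u x} → m ≡ suc (a + b) → u < m →
    Gap x a → Gap (x ⊕ (suc a + u)) b → FreeLabelTwoGapBergeCycle m E
  separated-gaps⇒cycle {a} {b} {u} {x} eq u<m (gap s s≤a xs xe) (gap t t≤b ys ye) = record
    { d = suc a
    ; e = suc b
    ; 1≤d = s≤s z≤n
    ; d≤2m-1 = length-bound a b eq
    ; 1≤e = s≤s z≤n
    ; e≤2m-1 = length-bound b a eq′
    ; d+e≡m+1 = lengths a b eq
    ; x = x
    ; y = y
    ; disjoint = disjoint
    ; i = x ⊕ s
    ; j = y ⊕ t
    ; i≢j = λ i≡j → disjoint (x ⊕ s , x∈p∩q⁺ (i∈I , subst (_∈ [ y , y ⊕ b ]⁺) (sym i≡j) j∈J))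
    ; i∈I∪J = x∈p∪q⁺ (inj₁ i∈I)
    ; j∈I∪J = x∈p∪q⁺ (inj₂ j∈J)
    ; xGap = xs , xe
    ; yGap = ys , ye
    }
    where
    y : Fin (2 * m)
    y = x ⊕ (suc a + u)

    eq′ : m ≡ suc (b + a)
    eq′ = trans eq (cong suc (+-comm a b))

    i∈I : x ⊕ s ∈ [ x , x ⊕ a ]⁺
    i∈I = ∈-interval⁺ x (a<2m a b eq) s≤a

    j∈J : y ⊕ t ∈ [ y , y ⊕ b ]⁺
    j∈J = ∈-interval⁺ y (a<2m b a eq′) t≤b

    disjoint : Empty ([ x , x ⊕ a ]⁺ ∩ [ y , y ⊕ b ]⁺)
    disjoint (z , z∈) with z∈I , z∈J ← x∈p∩q⁻ [ x , x ⊕ a ]⁺ _ z∈ =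
      <⇒≱ (m≤m+n (suc a) (u + offset y z)) (begin
        suc a + (u + offset y z)  ≡⟨ +-assoc (suc a) u _ ⟨
        suc a + u + offset y z    ≡⟨ offset-sum ⟨
        offset x z                ≤⟨ ∈-interval⁻ x (a<2m a b eq) z∈I ⟩
        a                         ∎)
      where
      open ≤-Reasoning
      -- Both sides are below 2m, the right one by `gap-sum`, so they agree as numbers and not only
      -- modulo 2m.
      offset-sum : offset x z ≡ suc a + u + offset y z
      offset-sum = ⊕-cancelˡ-< x (offset<n x z)
        (≤-<-trans (+-monoʳ-≤ (suc a + u) (∈-interval⁻ y (a<2m b a eq′) z∈J)) (gap-sum a b u eq u<m))
        (trans (⊕-offset x z) (trans (sym (⊕-offset y z)) (⊕-⊕ x _ _)))

  -- In the column k with k + K = m - 1, the point p ⊕ spinOffset K s is p - k for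
  -- s = + and p - k + m for s = -.
  spinOffset : ℕ → Sign → ℕ
  spinOffset K Sign.+ = suc K + m
  spinOffset K Sign.- = suc K

  private
    2m≡k+ : ∀ k K {m} → m ≡ suc (k + K) → 2 * m ≡ k + (suc K + m)
    2m≡k+ k K {m} eq = begin
      m + (m + 0)          ≡⟨ cong (m +_) (+-identityʳ m) ⟩
      m + m                ≡⟨ cong (_+ m) eq ⟩
      suc (k + K) + m      ≡⟨ cong (_+ m) (+-suc k K) ⟨
      k + suc K + m        ≡⟨ +-assoc k (suc K) m ⟩
      k + (suc K + m)      ∎
      where open ≡-Reasoning

  ⊖-spinOffset : ∀ (p : Fin (2 * m)) {k K} → m ≡ suc (k + K) → p ⊖ k ≡ p ⊕ spinOffset K Sign.+
  ⊖-spinOffset p {k} {K} eq = cong (p ⊕_) (begin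
    2 * m ∸ k % (2 * m)    ≡⟨ cong (2 * m ∸_) (m<n⇒m%n≡m (a<2m k K eq)) ⟩
    2 * m ∸ k              ≡⟨ cong (_∸ k) (2m≡k+ k K eq) ⟩
    k + (suc K + m) ∸ k    ≡⟨ m+n∸m≡n k _ ⟩
    suc K + m              ∎)
    where open ≡-Reasoning

  ⊕-spinOffset⁺⊕m : ∀ (p : Fin (2 * m)) K → p ⊕ spinOffset K Sign.+ ⊕ m ≡ p ⊕ spinOffset K Sign.-
  ⊕-spinOffset⁺⊕m p K = trans (cong (_⊕ m) (sym (⊕-⊕ p (suc K) m))) (⊕m⊕m (p ⊕ suc K))

  private
    ⊖⊕m-spinOffset : ∀ (p : Fin (2 * m)) {k K} → m ≡ suc (k + K) → p ⊖ k ⊕ m ≡ p ⊕ spinOffset K Sign.-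
    ⊖⊕m-spinOffset p {K = K} eq = trans (cong (_⊕ m) (⊖-spinOffset p eq)) (⊕-spinOffset⁺⊕m p K)

  spin-just⁻ : ∀ {p k K s} → m ≡ suc (k + K) → spin m E p k ≡ just s → p ⊕ spinOffset K s ∈ E p
  spin-just⁻ {p} {k} eq sp with p ⊖ k ∈? E p
  spin-just⁻ {p} {k} eq refl | yes h = subst (_∈ E p) (⊖-spinOffset p eq) h
  ... | no _ with p ⊖ k ⊕ m ∈? E p
  spin-just⁻ {p} {k} eq refl | no _ | yes h = subst (_∈ E p) (⊖⊕m-spinOffset p eq) h

  spin-nothing⁻ : ∀ {p k K} → m ≡ suc (k + K) → spin m E p k ≡ nothing → ∀ s → p ⊕ spinOffset K s ∉ E p
  spin-nothing⁻ {p} {k} eq sp s h with p ⊖ k ∈? E p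
  ... | no h⁺ with p ⊖ k ⊕ m ∈? E p
  spin-nothing⁻ {p} eq sp Sign.+ h | no h⁺ | no h⁻ = h⁺ (subst (_∈ E p) (sym (⊖-spinOffset p eq)) h)
  spin-nothing⁻ {p} eq sp Sign.- h | no h⁺ | no h⁻ = h⁻ (subst (_∈ E p) (sym (⊖⊕m-spinOffset p eq)) h)

  -- Constraints between spins when there is no cycle.

  module _ (H : IsCentralAntipodalFreeHamiltonian m E) (acyclic : ¬ FreeLabelTwoGapBergeCycle m E) where

    open IsCentralAntipodalFreeHamiltonian H

    -- The interval runs from p - k to p, with row p as its last point; the far end p + 1 lies in
    -- the label by the Hamiltonian condition.
    gap⁺ : ∀ {p k K} → m ≡ suc (k + K) → spin m E p k ≡ just Sign.+ → Gap (p ⊕ (suc K + m)) k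
    gap⁺ {p} {k} {K} eq sp = gap k ≤-refl
      (subst (p ⊕ (suc K + m) ∈_) (cong E (sym toRow)) (spin-just⁻ eq sp))
      (subst₂ (λ x q → x ∈ E q) (sym toNext) (sym toRow) (proj₂ (hamiltonian p)))
      where
      toRow : p ⊕ (suc K + m) ⊕ k ≡ p
      toRow = trans (⊕-⊕ p _ k) (trans (⊕-2m p (trans (+-comm _ k) (sym (2m≡k+ k K eq)))) (⊕-0 p))

      toNext : p ⊕ (suc K + m) ⊕ suc k ≡ p ⊕ 1
      toNext = trans (⊕-⊕ p _ (suc k))
        (⊕-2m p (trans (+-comm _ (suc k)) (cong suc (sym (2m≡k+ k K eq)))))

    -- The interval runs from p to p + K, with row p as its first point; the far end is p + K + 1 =
    -- p - k + m.
    gap⁻ : ∀ {p k K} → m ≡ suc (k + K) → spin m E p k ≡ just Sign.- → Gap p K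
    gap⁻ {p} eq sp = gap 0 z≤n
      (subst (p ∈_) (cong E (sym (⊕-0 p))) (proj₁ (hamiltonian p)))
      (subst (_ ∈_) (cong E (sym (⊕-0 p))) (spin-just⁻ eq sp))

    -- Constraint (a): the interval of the + ends at p and that of the - starts at p + 1 + u,
    -- leaving u points between them.
    plus-then-minus : ∀ {p k K u} → m ≡ suc (k + K) → u < m →
      spin m E p k ≡ just Sign.+ → spin m E (p ⊕ suc u) k ≢ just Sign.-
    plus-then-minus {p} {k} {K} {u} eq u<m sp sq =
      acyclic (separated-gaps⇒cycle eq u<m (gap⁺ eq sp)
        (subst (λ y → Gap y K) (sym meet) (gap⁻ eq sq)))
      where
      rearrange : ∀ m → m ≡ suc (k + K) → suc K + m + (suc k + u) ≡ suc u + 2 * m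
      rearrange _ refl = identity k K u
        where
        identity : ∀ k K u → suc K + suc (k + K) + (suc k + u) ≡ suc u + 2 * suc (k + K)
        identity = solve-∀

      meet : p ⊕ (suc K + m) ⊕ (suc k + u) ≡ p ⊕ suc u
      meet = trans (⊕-⊕ p _ _) (⊕-2m p (rearrange m eq))

    -- Constraint (b): for + the intervals end at the two rows, for - they start there. In both
    -- cases u points lie between them.
    complementary-columns : ∀ {p k K u s} → m ≡ suc (k + K) → u < m →
      spin m E p k ≡ just s → spin m E (p ⊕ (suc K + u)) K ≢ just s
    complementary-columns {p} {k} {K} {u} {Sign.+} eq u<m sp sq =
      acyclic (separated-gaps⇒cycle eq u<m (gap⁺ eq sp)
        (subst (λ y → Gap y K) meet (gap⁺ (trans eq (cong suc (+-comm k K))) sq)))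
      where
      rearrange : ∀ k K u m → (suc K + u) + (suc k + m) ≡ (suc K + m) + (suc k + u)
      rearrange = solve-∀

      meet : p ⊕ (suc K + u) ⊕ (suc k + m) ≡ p ⊕ (suc K + m) ⊕ (suc k + u)
      meet = trans (⊕-⊕ p _ _) (trans (cong (p ⊕_) (rearrange k K u m)) (sym (⊕-⊕ p _ _)))
    complementary-columns {k = k} {K} {s = Sign.-} eq u<m sp sq =
      acyclic (separated-gaps⇒cycle eq′ u<m (gap⁻ eq sp) (gap⁻ eq′ sq))
      where
      eq′ : m ≡ suc (K + k)
      eq′ = trans eq (cong suc (+-comm k K))

    -- Two zeros would make the label miss two antipodal pairs, distinct as k ≠ K, whereas m - 1
    -- elements in different pairs miss only one of the m pairs.
    one-zero-per-row : ∀ {p k K} → m ≡ suc (k + K) → k ≢ K →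
      spin m E p k ≡ nothing → spin m E p K ≢ nothing
    one-zero-per-row {p} {k} {K} eq k≢K zk zK =
      1+n≰n (begin
        1 + m          ≡⟨ cong suc eq ⟩
        2 + (k + K)    ≡⟨ cong (2 +_) (trans (size p) (cong (_∸ 1) eq)) ⟨
        2 + ∣ E p ∣    ≤⟨ two-classes-missing⇒2+∣S∣≤m (E p) (antipodalFree p)
                            (spin-nothing⁻ eq zk Sign.-)
                            (subst (_∉ E p) (sym (⊕-⊕ p _ m)) (spin-nothing⁻ eq zk Sign.+))
                            (spin-nothing⁻ eq′ zK Sign.-)
                            (subst (_∉ E p) (sym (⊕-⊕ p _ m)) (spin-nothing⁻ eq′ zK Sign.+))
                            K≢k K≢k+m ⟩
        m              ∎)
      where
      open ≤-Reasoning
      eq′ : m ≡ suc (K + k)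
      eq′ = trans eq (cong suc (+-comm k K))

      K<m : K < m
      K<m = subst (K <_) (sym eq) (s≤s (m≤n+m K k))

      k<m : k < m
      k<m = subst (k <_) (sym eq) (s≤s (m≤m+n k K))

      m+m≡2m : m + m ≡ 2 * m
      m+m≡2m = cong (m +_) (sym (+-identityʳ m))

      bound : ∀ {j} → j < m → suc j + m ≤ 2 * m
      bound {j} j<m = subst (suc j + m ≤_) m+m≡2m (+-monoˡ-≤ m j<m)

      suc<2m : ∀ {j} → j < m → suc j < 2 * m
      suc<2m {j} j<m = <-≤-trans (m<m+n (suc j) (>-nonZero⁻¹ m)) (bound j<m)

      K≢k : p ⊕ suc K ≢ p ⊕ suc k
      K≢k e = k≢K (sym (suc-injective (⊕-cancelˡ-< p (suc<2m K<m) (suc<2m k<m) e)))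

      K≢k+m : p ⊕ suc K ≢ p ⊕ suc k ⊕ m
      K≢k+m e with suc k ≟ m
      -- Here k + 1 + m is a full turn, so the right side is p itself; otherwise both shifts stay
      -- below 2m and can be compared.
      ... | yes refl = 1+n≢0 (⊕-cancelˡ-< p (suc<2m K<m) (≤-<-trans z≤n (suc<2m K<m))
              (trans e (trans (⊕m⊕m p) (sym (⊕-0 p)))))
      ... | no k+1≢m = <⇒≢ (≤-<-trans K<m (m<n+m m (s≤s z≤n)))
              (⊕-cancelˡ-< p (suc<2m K<m) (bound (≤∧≢⇒< k<m k+1≢m)) (trans e (⊕-⊕ p _ m)))

    -- Constancy of the sign in a column.

    minus-plus : ∀ {q k K} → m ≡ suc (k + K) → k ≢ K → spin m E q k ≡ just Sign.- →
      ∀ fuel s → m ≤ s + fuel → s < 2 * m → spin m E (q ⊕ s) k ≢ just Sign.+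
    minus-plus {q} {k} {K} eq k≢K sq = climb
      where
      K<m : K < m
      K<m = subst (K <_) (sym eq) (s≤s (m≤n+m K k))

      s<m : ∀ s → s < 2 * m → spin m E (q ⊕ s) k ≡ just Sign.+ → s < m
      s<m s s<2m sp with s <? m
      ... | yes s<m = s<m
      -- From row q + s, row q is reached after 2m - s ≤ m further steps, so (a) forbids the -
      -- there.
      ... | no s≮m with u , 1+s+u≡2m ← m≤n⇒∃[o]m+o≡n s<2m =
        contradiction (subst (λ z → spin m E z k ≡ just Sign.-) (sym back) sq)
          (plus-then-minus eq u<m sp)
        where
        back : q ⊕ s ⊕ suc u ≡ q
        back = trans (⊕-⊕ q s (suc u)) (trans (⊕-2m q (trans (+-suc s u) 1+s+u≡2m)) (⊕-0 q))

        u<m : u < m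
        u<m = +-cancelˡ-≤ m (suc u) m (begin
          m + suc u    ≤⟨ +-monoˡ-≤ (suc u) (≮⇒≥ s≮m) ⟩
          s + suc u    ≡⟨ +-suc s u ⟩
          suc s + u    ≡⟨ 1+s+u≡2m ⟩
          m + (m + 0)  ≡⟨ cong (m +_) (+-identityʳ m) ⟩
          m + m        ∎)
          where open ≤-Reasoning

      climb : ∀ fuel s → m ≤ s + fuel → s < 2 * m → spin m E (q ⊕ s) k ≢ just Sign.+
      -- Each round adds K + 1 ≥ 1 to s and spends one unit of fuel, keeping m ≤ s + fuel; with no
      -- fuel left this contradicts s < m.
      climb zero s m≤s s<2m sp = <⇒≱ (s<m s s<2m sp) (subst (m ≤_) (+-identityʳ s) m≤s)
      climb (suc fuel) s m≤s+fuel s<2m sp with spin m E (q ⊕ (s + suc K)) K in spK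
      -- In column K of row q + s + K + 1, a + is excluded by the + in row q + s, and a - by the -
      -- in row q, by (b) with gaps 0 and s.
      ... | just Sign.+ = complementary-columns eq (≤-<-trans z≤n K<m) sp
              (trans (cong (λ r → spin m E r K)
                (trans (⊕-⊕ q s _) (cong (λ r → q ⊕ (s + suc r)) (+-identityʳ K)))) spK)
      ... | just Sign.- = complementary-columns eq (s<m s s<2m sp) sq
              (trans (cong (λ r → spin m E (q ⊕ r) K) (+-comm (suc K) s)) spK)
      ... | nothing with spin m E (q ⊕ (s + suc K)) k in spk
      ...   | nothing = one-zero-per-row eq k≢K spk spK
      ...   | just Sign.- = plus-then-minus eq K<m sp
                (trans (cong (λ r → spin m E r k) (⊕-⊕ q s (suc K))) spk)
      ...   | just Sign.+ = climb fuel (s + suc K) further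
                (+-mono-<-≤ (s<m s s<2m sp) (subst (suc K ≤_) (sym (+-identityʳ m)) K<m)) spk
        where
        open ≤-Reasoning
        further : m ≤ s + suc K + fuel
        further = begin
          m                    ≤⟨ m≤s+fuel ⟩
          s + suc fuel         ≤⟨ +-monoʳ-≤ s (s≤s (m≤n+m fuel K)) ⟩
          s + (suc K + fuel)   ≡⟨ +-assoc s (suc K) fuel ⟨
          s + suc K + fuel     ∎

    column-constant : ∀ {p q k K s t} → m ≡ suc (k + K) → k ≢ K →
      spin m E p k ≡ just s → spin m E q k ≡ just t → s ≡ t
    column-constant {s = Sign.+} {Sign.+} _ _ _ _ = refl
    column-constant {s = Sign.-} {Sign.-} _ _ _ _ = refl
    column-constant {p} {q} {k} {s = Sign.+} {Sign.-} eq k≢K sp sq =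
      contradiction (trans (cong (λ r → spin m E r k) (⊕-offset q p)) sp)
        (minus-plus eq k≢K sq m (offset q p) (m≤n+m m _) (offset<n q p))
    column-constant {s = Sign.-} {Sign.+} eq k≢K sp sq =
      sym (column-constant eq k≢K sq sp)

    -- Opposite signs in complementary columns.

    columns-opposite : ∀ {p q k K s t} → m ≡ suc (k + K) → k ≢ K →
      spin m E p k ≡ just s → spin m E q K ≡ just t → t ≡ opposite s
    columns-opposite {p} {q} {k} {K} {s} {t} eq k≢K sp sq with t Sign.≟ s
    ... | no t≢s = flip t s t≢s
      where
      flip : ∀ t s → t ≢ s → t ≡ opposite s
      flip Sign.+ Sign.+ t≢s = contradiction refl t≢s
      flip Sign.+ Sign.- _   = refl
      flip Sign.- Sign.+ _   = refl
      flip Sign.- Sign.- t≢s = contradiction refl t≢s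
    -- Row q + m + k lies K + 1 steps before q, so an s there in column k contradicts the s in row q
    -- of column K.
    ... | yes refl = contradiction (subst (λ r → spin m E r K ≡ just s) (sym around) sq)
        (complementary-columns eq (>-nonZero⁻¹ m) (everywhere (q ⊕ (m + k))))
      where
      eq′ : m ≡ suc (K + k)
      eq′ = trans eq (cong suc (+-comm k K))

      -- Column K carries only the sign s, which (b) forbids in the new row. Its spin there is 0, so
      -- column k is nonzero and, by constancy, has s.
      step : ∀ {u} → u < m → ∀ p → spin m E p k ≡ just s → spin m E (p ⊕ (suc K + u)) k ≡ just s
      step {u} u<m p sp with spin m E (p ⊕ (suc K + u)) K in spK
      ... | just t = contradiction
              (trans spK (cong just (column-constant eq′ (k≢K ∘ sym) spK sq)))
              (complementary-columns eq u<m sp)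
      ... | nothing with spin m E (p ⊕ (suc K + u)) k in spk
      ...   | nothing = contradiction spK (one-zero-per-row eq k≢K spk)
      ...   | just t  = cong just (column-constant eq k≢K spk sp)

      steps : ∀ {u} → u < m → ∀ c p → spin m E p k ≡ just s → spin m E (p ⊕ (c * (suc K + u))) k ≡ just s
      steps u<m zero    p sp = trans (cong (λ r → spin m E r k) (⊕-0 p)) sp
      steps u<m (suc c) p sp = trans (cong (λ r → spin m E r k) (sym (⊕-⊕ p _ _)))
                                     (steps u<m c _ (step u<m p sp))

      1<m : 1 < m
      1<m = subst (1 <_) (sym eq) (s≤s (n≢0⇒n>0 λ k+K≡0 →
        k≢K (trans (m+n≡0⇒m≡0 k k+K≡0) (sym (m+n≡0⇒n≡0 k k+K≡0)))))

      -- Since m + k + K = 2m - 1 acts as -1 modulo 2m, c shifts by K + 2 and c (2m - 1) shifts by K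
      -- + 1 amount to a net shift by c.
      rearrange : ∀ m c → m ≡ suc (k + K) →
        c * (suc K + 1) + c * (m + k + K) * (suc K + 0) ≡ c + c * suc K * (2 * m)
      rearrange _ c refl = identity k K c
        where
        identity : ∀ k K c →
          c * (suc K + 1) + c * (suc (k + K) + k + K) * (suc K + 0) ≡ c + c * suc K * (2 * suc (k + K))
        identity = solve-∀

      everywhere : ∀ r → spin m E r k ≡ just s
      everywhere r = subst (λ z → spin m E z k ≡ just s) reach
        (steps (>-nonZero⁻¹ m) (c * (m + k + K)) _ (steps 1<m c p sp))
        where
        c = offset p r
        reach : p ⊕ (c * (suc K + 1)) ⊕ (c * (m + k + K) * (suc K + 0)) ≡ r
        reach = trans (⊕-⊕ p _ _) (trans (cong (p ⊕_) (rearrange m c eq))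
          (trans (⊕-multiple p c (c * suc K)) (⊕-offset p r)))

      full-turn : ∀ m → m ≡ suc (k + K) → m + k + (suc K + 0) ≡ 2 * m
      full-turn _ refl = identity k K
        where
        identity : ∀ k K → suc (k + K) + k + (suc K + 0) ≡ 2 * suc (k + K)
        identity = solve-∀

      around : q ⊕ (m + k) ⊕ (suc K + 0) ≡ q
      around = trans (⊕-⊕ q _ _) (trans (⊕-2m q (full-turn m eq)) (⊕-0 q))

    -- Choice of the column signs.

    referenceRow : Fin (2 * m)
    referenceRow = 0 mod (2 * m)

    -- A single row determines the sign of a noncentral column: either its own spin or that of the
    -- complementary column is nonzero there.
    columnSign : ℕ → Sign
    columnSign k = fromSpins (spin m E referenceRow k) (spin m E referenceRow (bar m k))
      where
      fromSpins : Maybe Sign → Maybe Sign → Sign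
      fromSpins (just s) _        = s
      fromSpins nothing  (just t) = opposite t
      -- A default value; `one-zero-per-row` excludes this case for noncentral columns.
      fromSpins nothing  nothing  = Sign.+

    columnSign-bar : ∀ k → k ≤ m ∸ 2 → k ≢ bar m k → columnSign (bar m k) ≡ opposite (columnSign k)
    -- After the rewrite both signs are read from the same two spins, in swapped order.
    columnSign-bar k k≤m-2 k≢K rewrite bar-involutive k k≤m-2
      with spin m E referenceRow k in spk | spin m E referenceRow (bar m k) in spK
    ... | just s  | just t  = columns-opposite (m≡1+k+bar k k≤m-2) k≢K spk spK
    ... | just s  | nothing = refl
    ... | nothing | just t  = sym (opposite-involutive t)
    ... | nothing | nothing = contradiction spK (one-zero-per-row (m≡1+k+bar k k≤m-2) k≢K spk)

    spin≡columnSign : ∀ p k → k ≤ m ∸ 2 → k ≢ bar m k →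
      spin m E p k ≢ nothing → spin m E p k ≡ just (columnSign k)
    spin≡columnSign p k k≤m-2 k≢K nonzero with spin m E p k in sp
    ... | nothing = contradiction refl nonzero
    ... | just v with spin m E referenceRow k in spk | spin m E referenceRow (bar m k) in spK
    ...   | just s  | _       = cong just (column-constant (m≡1+k+bar k k≤m-2) k≢K sp spk)
    ...   | nothing | just t  = cong just (sym (trans
            (cong opposite (columns-opposite (m≡1+k+bar k k≤m-2) k≢K sp spK)) (opposite-involutive v)))
    ...   | nothing | nothing = contradiction spK (one-zero-per-row (m≡1+k+bar k k≤m-2) k≢K spk)

-- Parity of m and the central column.

theorem6p7 : (m : ℕ) .{{_ : NonZero m}} (E : Labels m) →
    IsCentralAntipodalFreeHamiltonian m E →
    ¬ FreeLabelTwoGapBergeCycle m E →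
    (2 ∣ m →
      Σ[ σ ∈ (ℕ → Sign) ]
        (∀ k → 1 ≤ k → k ≤ m ∸ 2 → σ (bar m k) ≡ opposite (σ k)) ×
        (∀ (p : Fin (2 * m)) k → 1 ≤ k → k ≤ m ∸ 2 →
          spin m E p k ≢ nothing → spin m E p k ≡ just (σ k))) ×
    (∀ h → m ≡ 2 * h + 1 →
      Σ[ σ ∈ (ℕ → Sign) ]
        (∀ k → 1 ≤ k → k ≤ m ∸ 2 → k ≢ h → σ (bar m k) ≡ opposite (σ k)) ×
        (∀ (p : Fin (2 * m)) k → 1 ≤ k → k ≤ m ∸ 2 → k ≢ h →
          spin m E p k ≢ nothing → spin m E p k ≡ just (σ k)))
theorem6p7 m E H acyclic = even , odd
  where
  σ : ℕ → Sign
  σ = columnSign H acyclic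

  self-bar⇒m≡1+k+k : ∀ {k} → k ≤ m ∸ 2 → k ≡ bar m k → m ≡ suc (k + k)
  self-bar⇒m≡1+k+k {k} k≤m-2 k≡K =
    trans (m≡1+k+bar k k≤m-2) (cong (λ j → suc (k + j)) (sym k≡K))

  k+k≡2*k : ∀ k → k + k ≡ 2 * k
  k+k≡2*k k = cong (k +_) (sym (+-identityʳ k))

  even : 2 ∣ m → _
  even 2∣m = σ
    , (λ k _ k≤m-2 → columnSign-bar H acyclic k k≤m-2 (noncentral k≤m-2))
    , (λ p k _ k≤m-2 → spin≡columnSign H acyclic p k k≤m-2 (noncentral k≤m-2))
    where
    noncentral : ∀ {k} → k ≤ m ∸ 2 → k ≢ bar m k
    -- A self-complementary column gives m = 2k + 1, so 2 would divide 1.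
    noncentral {k} k≤m-2 k≡K = contradiction
      (∣1⇒≡1 (∣m+n∣m⇒∣n
        (subst (2 ∣_) (trans (self-bar⇒m≡1+k+k k≤m-2 k≡K) (+-comm 1 (k + k))) 2∣m)
        (subst (2 ∣_) (sym (k+k≡2*k k)) (m∣m*n k))))
      λ ()

  odd : ∀ h → m ≡ 2 * h + 1 → _
  odd h m≡2h+1 = σ
    , (λ k _ k≤m-2 k≢h → columnSign-bar H acyclic k k≤m-2 (noncentral k≤m-2 k≢h))
    , (λ p k _ k≤m-2 k≢h → spin≡columnSign H acyclic p k k≤m-2 (noncentral k≤m-2 k≢h))
    where
    noncentral : ∀ {k} → k ≤ m ∸ 2 → k ≢ h → k ≢ bar m k
    noncentral {k} k≤m-2 k≢h k≡K = k≢h (*-cancelˡ-≡ k h 2 (suc-injective (begin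
      suc (2 * k)  ≡⟨ cong suc (k+k≡2*k k) ⟨
      suc (k + k)  ≡⟨ self-bar⇒m≡1+k+k k≤m-2 k≡K ⟨
      m            ≡⟨ m≡2h+1 ⟩
      2 * h + 1    ≡⟨ +-comm (2 * h) 1 ⟩
      suc (2 * h)  ∎)))
      where open ≡-Reasoning
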